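{- Let $A$ be a formula of $\mathrm{SN}$ that does not contain the constant $t$ and contains no subformula of the form $NB$ with $B$ non-atomic (so $A$ is also a formula of $\mathbf{CN}$, with atomic formulas $p$ and $Np$). Then $\mathbf{CN}\vdash A$ if and only if $\mathrm{SN}\vdash t\to A$.
   Context: $\mathbf{CN}$: atomic formulas are $p$ and $Np$ for basic atoms $p$ (treated as distinct classical atoms), formulas use classical connectives, and $\mathbf{CN}\vdash A$ iff $\{Np\to\neg p\mid p\text{ basic atom}\}\vdash A$ in classical propositional logic. $\mathrm{SN}$: formulas are built from atoms $p$, $\top,\bot$, a propositional constant $t$, with $\neg,\wedge,\vee,\to$ and a unary connective $N$ (applicable to any formula). $\mathrm{SN}\vdash A$ is generated by all classical tautologies; axioms (K) $N(A\wedge B)\leftrightarrow NA\vee NB$; (F) $\neg NA\leftrightarrow N\neg A$; (C) $A\to NNA$; (A) $t\to(p\to N\neg p)$ for atoms $p$; (T) $t\leftrightarrow Nt$; rules modus ponens and (N): from $A$ infer $N\neg A$. (Semantically, $\mathrm{SN}$-models are $(\{1,2\},v)$ with $v(p)\subseteq\{1,2\}$, $1\in v(p)\Rightarrow 2\in v(p)$; $m\vDash t$ iff $m=1$; classical clauses; $1\vDash NA$ iff $2\nvDash A$, $2\vDash NA$ iff $1\nvDash A$.) -}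

module Defs where

open import Data.Bool using (Bool; true; false; not; _∧_; _∨_)
open import Data.Empty using (⊥-elim)
open import Function using (_∘_)
open import Level using (0ℓ)
open import Relation.Binary.PropositionalEquality using (_≡_; refl; cong; cong₂)
open import Relation.Nullary using (¬_)
open import Relation.Unary using (Pred)

module Classical where

  infix  8 `¬_
  infixr 7 _`∧_
  infixr 6 _`∨_
  infixr 5 _`→_
  infix  3 _⊢_

  data Formula (X : Set) : Set where
    var            : X → Formula X
    `⊤ `⊥          : Formula X
    `¬_            : Formula X → Formula X
    _`∧_ _`∨_ _`→_ : Formula X → Formula X → Formula X

  eval : {X : Set} → (X → Bool) → Formula X → Bool
  eval v (var x)  = v x
  eval v `⊤       = true
  eval v `⊥       = false
  eval v (`¬ A)   = not (eval v A)
  eval v (A `∧ B) = eval v A ∧ eval v B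
  eval v (A `∨ B) = eval v A ∨ eval v B
  eval v (A `→ B) = not (eval v A) ∨ eval v B

  Tautology : {X : Set} → Formula X → Set
  Tautology A = ∀ v → eval v A ≡ true

  -- Derivability from a possibly infinite set of premises, with the
  -- tautologies as logical axioms and modus ponens as the only rule.
  data _⊢_ {X : Set} (Γ : Pred (Formula X) 0ℓ) : Formula X → Set where
    premise : ∀ {A} → Γ A → Γ ⊢ A
    taut    : ∀ {A} → Tautology A → Γ ⊢ A
    mp      : ∀ {A B} → Γ ⊢ A `→ B → Γ ⊢ A → Γ ⊢ B

module CN where

  open Classical using (var; `¬_; _`→_)

  infix 3 ⊢_

  -- p and N p are distinct, logically independent atomic formulas.
  data Literal (Atom : Set) : Set where
    pos neg : Atom → Literal Atom

  Formula : Set → Set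
  Formula Atom = Classical.Formula (Literal Atom)

  data Theory {Atom : Set} : Pred (Formula Atom) 0ℓ where
    N→¬ : ∀ p → Theory (var (neg p) `→ `¬ var (pos p))

  ⊢_ : {Atom : Set} → Formula Atom → Set
  ⊢ A = Theory Classical.⊢ A

module SN where

  infix  8 `¬_
  infixr 7 _`∧_
  infixr 6 _`∨_
  infixr 5 _`→_
  infix  4 _`↔_
  infix  3 ⊢_
  infix  3 _⊑_

  data Formula (Atom : Set) : Set where
    atom           : Atom → Formula Atom
    `⊤ `⊥ t        : Formula Atom
    `¬_ N          : Formula Atom → Formula Atom
    _`∧_ _`∨_ _`→_ : Formula Atom → Formula Atom → Formula Atom

  _`↔_ : {Atom : Set} → Formula Atom → Formula Atom → Formula Atom
  A `↔ B = (A `→ B) `∧ (B `→ A)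

  -- The classical structure of a formula: atoms, t and all formulas N A
  -- are left unanalysed, as independent propositional variables.
  skeleton : {Atom : Set} → Formula Atom → Classical.Formula (Formula Atom)
  skeleton (atom p) = Classical.var (atom p)
  skeleton t        = Classical.var t
  skeleton (N A)    = Classical.var (N A)
  skeleton `⊤       = Classical.`⊤
  skeleton `⊥       = Classical.`⊥
  skeleton (`¬ A)   = Classical.`¬ skeleton A
  skeleton (A `∧ B) = skeleton A Classical.`∧ skeleton B
  skeleton (A `∨ B) = skeleton A Classical.`∨ skeleton B
  skeleton (A `→ B) = skeleton A Classical.`→ skeleton B

  data ⊢_ {Atom : Set} : Formula Atom → Set where
    taut   : ∀ {A} → Classical.Tautology (skeleton A) → ⊢ A
    axiomK : ∀ A B → ⊢ N (A `∧ B) `↔ N A `∨ N B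
    axiomF : ∀ A → ⊢ `¬ N A `↔ N (`¬ A)
    axiomC : ∀ A → ⊢ A `→ N (N A)
    axiomA : ∀ p → ⊢ t `→ (atom p `→ N (`¬ atom p))
    axiomT : ⊢ t `↔ N t
    mp     : ∀ {A B} → ⊢ A `→ B → ⊢ A → ⊢ B
    ruleN  : ∀ {A} → ⊢ A → ⊢ N (`¬ A)

  data _⊑_ {Atom : Set} (S : Formula Atom) : Formula Atom → Set where
    self  : S ⊑ S
    in-¬  : ∀ {A} → S ⊑ A → S ⊑ `¬ A
    in-N  : ∀ {A} → S ⊑ A → S ⊑ N A
    in-∧₁ : ∀ {A B} → S ⊑ A → S ⊑ A `∧ B
    in-∧₂ : ∀ {A B} → S ⊑ B → S ⊑ A `∧ B
    in-∨₁ : ∀ {A B} → S ⊑ A → S ⊑ A `∨ B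
    in-∨₂ : ∀ {A B} → S ⊑ B → S ⊑ A `∨ B
    in-→₁ : ∀ {A B} → S ⊑ A → S ⊑ A `→ B
    in-→₂ : ∀ {A B} → S ⊑ B → S ⊑ A `→ B

  data IsAtom {Atom : Set} : Formula Atom → Set where
    isAtom : ∀ p → IsAtom (atom p)

  atomOf : {Atom : Set} {A : Formula Atom} → IsAtom A → Atom
  atomOf (isAtom p) = p

  NoT : {Atom : Set} → Formula Atom → Set
  NoT A = ¬ (t ⊑ A)

  NOnlyOnAtoms : {Atom : Set} → Formula Atom → Set
  NOnlyOnAtoms A = ∀ B → N B ⊑ A → IsAtom B

open SN using (NoT; NOnlyOnAtoms; atomOf; self; in-¬; in-∧₁; in-∧₂; in-∨₁; in-∨₂; in-→₁; in-→₂)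

toCN : {Atom : Set} (A : SN.Formula Atom) → NoT A → NOnlyOnAtoms A → CN.Formula Atom
toCN (SN.atom p)   _ _ = Classical.var (CN.pos p)
toCN SN.`⊤         _ _ = Classical.`⊤
toCN SN.`⊥         _ _ = Classical.`⊥
toCN SN.t          h _ = ⊥-elim (h self)
toCN (SN.N B)      _ k = Classical.var (CN.neg (atomOf (k B self)))
toCN (SN.`¬ A)     h k = Classical.`¬ toCN A (h ∘ in-¬) (λ B → k B ∘ in-¬)
toCN (A SN.`∧ B)   h k = toCN A (h ∘ in-∧₁) (λ D → k D ∘ in-∧₁) Classical.`∧
                         toCN B (h ∘ in-∧₂) (λ D → k D ∘ in-∧₂)
toCN (A SN.`∨ B)   h k = toCN A (h ∘ in-∨₁) (λ D → k D ∘ in-∨₁) Classical.`∨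
                         toCN B (h ∘ in-∨₂) (λ D → k D ∘ in-∨₂)
toCN (A SN.`→ B)   h k = toCN A (h ∘ in-→₁) (λ D → k D ∘ in-→₁) Classical.`→
                         toCN B (h ∘ in-→₂) (λ D → k D ∘ in-→₂)

fromCN : {Atom : Set} → CN.Formula Atom → SN.Formula Atom
fromCN (Classical.var (CN.pos p)) = SN.atom p
fromCN (Classical.var (CN.neg p)) = SN.N (SN.atom p)
fromCN Classical.`⊤               = SN.`⊤
fromCN Classical.`⊥               = SN.`⊥
fromCN (Classical.`¬ A)           = SN.`¬ fromCN A
fromCN (A Classical.`∧ B)         = fromCN A SN.`∧ fromCN B
fromCN (A Classical.`∨ B)         = fromCN A SN.`∨ fromCN B
fromCN (A Classical.`→ B)         = fromCN A SN.`→ fromCN B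

-- toCN A is A itself, read as a formula of CN.
fromCN-toCN : {Atom : Set} (A : SN.Formula Atom) (h : NoT A) (k : NOnlyOnAtoms A) →
              fromCN (toCN A h k) ≡ A
fromCN-toCN (SN.atom p) _ _ = refl
fromCN-toCN SN.`⊤       _ _ = refl
fromCN-toCN SN.`⊥       _ _ = refl
fromCN-toCN SN.t        h _ = ⊥-elim (h self)
fromCN-toCN (SN.N B)    _ k with k B self
... | SN.isAtom p = refl
fromCN-toCN (SN.`¬ A)   _ _ = cong SN.`¬_ (fromCN-toCN A _ _)
fromCN-toCN (A SN.`∧ B) _ _ = cong₂ SN._`∧_ (fromCN-toCN A _ _) (fromCN-toCN B _ _)
fromCN-toCN (A SN.`∨ B) _ _ = cong₂ SN._`∨_ (fromCN-toCN A _ _) (fromCN-toCN B _ _)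
fromCN-toCN (A SN.`→ B) _ _ = cong₂ SN._`→_ (fromCN-toCN A _ _) (fromCN-toCN B _ _)

{-# OPTIONS --safe #-}

-- Left to right, axioms (A) and (F) yield t → (N p → ¬ p).  Right to left, a
-- valuation v of the literals p, N p gives an SN-model w by
-- 1 ∈ w(p) iff v(p) ∧ ¬ v(N p) and 2 ∈ w(p) iff ¬ v(N p).  By soundness A holds at its
-- point 1, which agrees with v on A as soon as v satisfies N p → ¬ p for the
-- atoms of A.  As only finitely many premises are involved, A is a tautological
-- consequence of them.
module Submission where

open import Defs
open import Data.Bool using (Bool; true; false; not; _∧_; _∨_)
open import Data.Bool.Properties
  using (not-involutive; ∧-conicalˡ; ∧-conicalʳ)
open import Function using (_∘_)
open import Function.Bundles using (_⇔_; mk⇔)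
open import Relation.Binary.PropositionalEquality
  using (_≡_; refl; sym; trans; cong; cong₂; subst)

open Classical using (eval)

private variable
  Atom : Set

→-intro : ∀ a {b} → (a ≡ true → b ≡ true) → not a ∨ b ≡ true
→-intro true  h = h refl
→-intro false _ = refl

→-elim : ∀ a {b} → not a ∨ b ≡ true → a ≡ true → b ≡ true
→-elim true h _ = h

↔-intro : ∀ {a b} → a ≡ b → (not a ∨ b) ∧ (not b ∨ a) ≡ true
↔-intro {true}  refl = refl
↔-intro {false} refl = refl

not-∧ : ∀ a b → not (a ∧ b) ≡ not a ∨ not b
not-∧ true  _ = refl
not-∧ false _ = refl

World : Set
World = Bool

-- The worlds 1 and 2 are true and false, so that t holds at m iff m is true.
sat : (World → Atom → Bool) → World → SN.Formula Atom → Bool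
sat V m (SN.atom p) = V m p
sat V m SN.`⊤       = true
sat V m SN.`⊥       = false
sat V m SN.t        = m
sat V m (SN.`¬ A)   = not (sat V m A)
sat V m (SN.N A)    = not (sat V (not m) A)
sat V m (A SN.`∧ B) = sat V m A ∧ sat V m B
sat V m (A SN.`∨ B) = sat V m A ∨ sat V m B
sat V m (A SN.`→ B) = not (sat V m A) ∨ sat V m B

-- The skeleton's variables are themselves formulas, so `sat V m` is one of the valuations that a
-- tautology quantifies over; this settles the `taut` case of soundness.
eval-skeleton : (V : World → Atom → Bool) (m : World) (A : SN.Formula Atom) →
                eval (sat V m) (SN.skeleton A) ≡ sat V m A
eval-skeleton V m (SN.atom p) = refl
eval-skeleton V m SN.`⊤       = refl
eval-skeleton V m SN.`⊥       = refl
eval-skeleton V m SN.t        = refl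
eval-skeleton V m (SN.N A)    = refl
eval-skeleton V m (SN.`¬ A)   = cong not (eval-skeleton V m A)
eval-skeleton V m (A SN.`∧ B) = cong₂ _∧_ (eval-skeleton V m A) (eval-skeleton V m B)
eval-skeleton V m (A SN.`∨ B) = cong₂ _∨_ (eval-skeleton V m A) (eval-skeleton V m B)
eval-skeleton V m (A SN.`→ B) =
  cong₂ (λ a b → not a ∨ b) (eval-skeleton V m A) (eval-skeleton V m B)

-- The induction treats both worlds at once, since `N` and hence `ruleN` pass from each world to the
-- other.
soundness : (V : World → Atom → Bool) → (∀ p → V true p ≡ true → V false p ≡ true) →
            ∀ {A} → SN.⊢ A → ∀ m → sat V m A ≡ true
soundness V mono (SN.taut {A} h)  m = trans (sym (eval-skeleton V m A)) (h (sat V m))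
soundness V mono (SN.axiomK A B)  m =
  ↔-intro (not-∧ (sat V (not m) A) (sat V (not m) B))
soundness V mono (SN.axiomF A)    m = ↔-intro {not (not (sat V (not m) A))} refl
soundness V mono (SN.axiomC A)    m = →-intro (sat V m A) λ a →
  trans (not-involutive _) (trans (cong (λ n → sat V n A) (not-involutive m)) a)
soundness V mono (SN.axiomA p)    false = refl
-- At point 1, `N (¬ p)` is the double negation of `p` at point 2, so (A) is exactly monotonicity.
soundness V mono (SN.axiomA p)    true  = →-intro (V true p) λ h →
  trans (not-involutive _) (mono p h)
soundness V mono SN.axiomT        m = ↔-intro (sym (not-involutive m))
soundness V mono (SN.mp {A} d e)  m =
  →-elim (sat V m A) (soundness V mono d m) (soundness V mono e m)
soundness V mono (SN.ruleN d)     m =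
  trans (not-involutive _) (soundness V mono d (not m))

-- `fromCN` sends every literal to a variable of the skeleton, so it merely renames variables and
-- preserves tautologies.
eval-fromCN : (v : SN.Formula Atom → Bool) (B : CN.Formula Atom) →
              eval v (SN.skeleton (fromCN B)) ≡ eval (v ∘ fromCN ∘ Classical.var) B
eval-fromCN v (Classical.var (CN.pos p)) = refl
eval-fromCN v (Classical.var (CN.neg p)) = refl
eval-fromCN v Classical.`⊤               = refl
eval-fromCN v Classical.`⊥               = refl
eval-fromCN v (Classical.`¬ A)           = cong not (eval-fromCN v A)
eval-fromCN v (A Classical.`∧ B)         = cong₂ _∧_ (eval-fromCN v A) (eval-fromCN v B)
eval-fromCN v (A Classical.`∨ B)         = cong₂ _∨_ (eval-fromCN v A) (eval-fromCN v B)
eval-fromCN v (A Classical.`→ B)         =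
  cong₂ (λ a b → not a ∨ b) (eval-fromCN v A) (eval-fromCN v B)

-- Stated through `fromCN`, which is total on CN formulas, so that the induction also covers the
-- arbitrary cut formulas of modus ponens.
CN⇒SN : {B : CN.Formula Atom} → CN.⊢ B → SN.⊢ SN.t SN.`→ fromCN B
CN⇒SN (Classical.premise (CN.N→¬ p)) =
  -- In the skeleton `N p` and `N (¬ p)` are unrelated variables; the instance of (F) links them.
  SN.mp (SN.mp (SN.taut λ v → A-and-F (v SN.t) (v (SN.atom p))
                                      (v (SN.N (SN.atom p))) (v (SN.N (SN.`¬ SN.atom p))))
               (SN.axiomA p))
        (SN.axiomF (SN.atom p))
  where
  exclusive : ∀ a n n¬ → not a ∨ n¬ ≡ true →
              (not (not n) ∨ n¬) ∧ (not n¬ ∨ not n) ≡ true → not n ∨ not a ≡ true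
  exclusive _     false _    _ _ = refl
  exclusive false true  _    _ _ = refl
  exclusive true  true  true _ ()

  A-and-F : ∀ t a n n¬ →
            not (not t ∨ (not a ∨ n¬)) ∨
            (not ((not (not n) ∨ n¬) ∧ (not n¬ ∨ not n)) ∨ (not t ∨ (not n ∨ not a))) ≡ true
  A-and-F t a n n¬ = →-intro (not t ∨ (not a ∨ n¬)) λ f →
    →-intro ((not (not n) ∨ n¬) ∧ (not n¬ ∨ not n)) λ g →
    →-intro t λ x → exclusive a n n¬ (→-elim t f x) g
CN⇒SN (Classical.taut {B} h) = SN.taut λ v →
  →-intro (v SN.t) λ _ → trans (eval-fromCN v B) (h (v ∘ fromCN ∘ Classical.var))
CN⇒SN (Classical.mp {A} {B} d e) =
  SN.mp (SN.mp (SN.taut λ v → distrib (v SN.t) (eval v (SN.skeleton (fromCN A)))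
                                      (eval v (SN.skeleton (fromCN B))))
               (CN⇒SN d))
        (CN⇒SN e)
  where
  distrib : ∀ t a b →
            not (not t ∨ (not a ∨ b)) ∨ (not (not t ∨ a) ∨ (not t ∨ b)) ≡ true
  distrib t a b =
    →-intro (not t ∨ (not a ∨ b)) λ f → →-intro (not t ∨ a) λ g → →-intro t λ x →
    →-elim a (→-elim t f x) (→-elim t g x)

-- The finitely many premises relevant to a formula, gathered along its own structure so that
-- inductions on the formula can split them. Only positive literals contribute: the model below
-- reproduces negative ones unconditionally.
premises : CN.Formula Atom → CN.Formula Atom
premises (Classical.var (CN.pos p)) =
  Classical.var (CN.neg p) Classical.`→ Classical.`¬ Classical.var (CN.pos p)
premises (Classical.var (CN.neg p)) = Classical.`⊤
premises Classical.`⊤               = Classical.`⊤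
premises Classical.`⊥               = Classical.`⊤
premises (Classical.`¬ A)           = premises A
premises (A Classical.`∧ B)         = premises A Classical.`∧ premises B
premises (A Classical.`∨ B)         = premises A Classical.`∧ premises B
premises (A Classical.`→ B)         = premises A Classical.`∧ premises B

⊢-∧ : {X : Set} {Γ : Classical.Formula X → Set} {A B : Classical.Formula X} →
      Γ Classical.⊢ A → Γ Classical.⊢ B → Γ Classical.⊢ A Classical.`∧ B
⊢-∧ {A = A} {B} d e = Classical.mp (Classical.mp (Classical.taut λ v →
  →-intro (eval v A) λ a → →-intro (eval v B) λ b → cong₂ _∧_ a b) d) e

⊢-premises : (B : CN.Formula Atom) → CN.⊢ premises B
⊢-premises (Classical.var (CN.pos p)) = Classical.premise (CN.N→¬ p)
⊢-premises (Classical.var (CN.neg p)) = Classical.taut λ _ → refl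
⊢-premises Classical.`⊤               = Classical.taut λ _ → refl
⊢-premises Classical.`⊥               = Classical.taut λ _ → refl
⊢-premises (Classical.`¬ A)           = ⊢-premises A
⊢-premises (A Classical.`∧ B)         = ⊢-∧ (⊢-premises A) (⊢-premises B)
⊢-premises (A Classical.`∨ B)         = ⊢-∧ (⊢-premises A) (⊢-premises B)
⊢-premises (A Classical.`→ B)         = ⊢-∧ (⊢-premises A) (⊢-premises B)

-- Point 2 is forced by the value wanted for `N p` at point 1. The extra conjunct at point 1 makes
-- the model monotone even when `v` violates a premise.
model : (CN.Literal Atom → Bool) → World → Atom → Bool
model v true  p = v (CN.pos p) ∧ not (v (CN.neg p))
model v false p = not (v (CN.neg p))

model-agrees : (v : CN.Literal Atom → Bool) (B : CN.Formula Atom) →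
               eval v (premises B) ≡ true →
               eval (sat (model v) true ∘ fromCN ∘ Classical.var) B ≡ eval v B
model-agrees v (Classical.var (CN.pos p)) h = absorb (v (CN.pos p)) (v (CN.neg p)) h
  where
  absorb : ∀ a n → not n ∨ not a ≡ true → a ∧ not n ≡ a
  absorb false n     _ = refl
  absorb true  false _ = refl
model-agrees v (Classical.var (CN.neg p)) h = not-involutive (v (CN.neg p))
model-agrees v Classical.`⊤               h = refl
model-agrees v Classical.`⊥               h = refl
model-agrees v (Classical.`¬ A)           h = cong not (model-agrees v A h)
model-agrees v (A Classical.`∧ B)         h = cong₂ _∧_
  (model-agrees v A (∧-conicalˡ _ _ h)) (model-agrees v B (∧-conicalʳ _ _ h))
model-agrees v (A Classical.`∨ B)         h = cong₂ _∨_
  (model-agrees v A (∧-conicalˡ _ _ h)) (model-agrees v B (∧-conicalʳ _ _ h))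
model-agrees v (A Classical.`→ B)         h = cong₂ (λ a b → not a ∨ b)
  (model-agrees v A (∧-conicalˡ _ _ h)) (model-agrees v B (∧-conicalʳ _ _ h))

SN⇒CN : (B : CN.Formula Atom) → SN.⊢ SN.t SN.`→ fromCN B → CN.⊢ B
SN⇒CN B d = Classical.mp (Classical.taut entails) (⊢-premises B)
  where
  entails : Classical.Tautology (premises B Classical.`→ B)
  entails v = →-intro (eval v (premises B)) λ h →
    trans (sym (model-agrees v B h))
    (trans (sym (eval-fromCN (sat (model v) true) B))
    (trans (eval-skeleton (model v) true (fromCN B))
           -- Monotonicity is projection to the second conjunct. At `true` the antecedent `t`
           -- computes to `true`, leaving the truth of `fromCN B`.
           (soundness (model v) (λ p → ∧-conicalʳ _ _) d true)))

theorem35 : (Atom : Set) (A : SN.Formula Atom)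
    (noT : SN.NoT A) (nAtomic : SN.NOnlyOnAtoms A) →
    (CN.⊢ toCN A noT nAtomic) ⇔ (SN.⊢ (SN.t SN.`→ A))
theorem35 Atom A noT nAtomic = mk⇔
  (λ d → subst (λ C → SN.⊢ SN.t SN.`→ C) A≡ (CN⇒SN d))
  (λ d → SN⇒CN _ (subst (λ C → SN.⊢ SN.t SN.`→ C) (sym A≡) d))
  where
  A≡ : fromCN (toCN A noT nAtomic) ≡ A
  A≡ = fromCN-toCN A noT nAtomic
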